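{- Let $G=(V,E)$ be a connected finite simple graph of order $n$ with minimum degree $\delta(G)\ge 2$. Then $Z(D_t(G,x))=\{ -3,0\}$ if and only if $G$ is (isomorphic to) the cycle $C_3$ or the cycle $C_6$.
   Context: For a finite simple graph $G=(V,E)$, a set $D\subseteq V$ is a total dominating set if every vertex of $V$ is adjacent to some vertex of $D$. $d_t(G,i)$ is the number of total dominating sets of $G$ of cardinality $i$, and $D_t(G,x)=\sum_i d_t(G,i)x^i$ is the total domination polynomial. $Z(D_t(G,x))$ denotes the set of distinct (complex) roots of $D_t(G,x)$. $C_n$ is the cycle of order $n$. -}

module Defs where

open import Algebra.Apartness.Bundles using (HeytingCommutativeRing; HeytingField)
open import Algebra.Bundles using (CommutativeRing; Semiring)
import Algebra.Definitions.RawSemiring as RawSemiringDefs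
open import Data.Fin.Base using (Fin; toℕ)
import Data.Fin.Properties as Fin
open import Data.Fin.Permutation using (Permutation; _⟨$⟩ʳ_)
open import Data.Fin.Subset using (Subset; inside; outside; _∈_; ∣_∣)
open import Data.Fin.Subset.Properties using (_∈?_)
open import Data.List.Base as List using (List; allFin; filter; map; _++_)
open import Data.List.Extrema.Nat using (min)
open import Data.Nat.Base using (ℕ; suc; _≤_; _<_; NonZero; s≤s)
open import Data.Nat.DivMod using (_%_; m<n⇒m%n≡m; n%n≡0)
import Data.Nat.Properties as ℕ
open import Data.Product.Base using (_×_; _,_; ∃-syntax; Σ-syntax)
open import Data.Sum.Base as Sum using (_⊎_; inj₁; inj₂; [_,_]′)
open import Data.Vec.Base using ([]; _∷_)
open import Data.Vec.Functional as Vector using (Vector)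
open import Function.Bundles using (_⇔_)
open import Level using (Level; 0ℓ; _⊔_) renaming (suc to lsuc)
open import Relation.Binary.Construct.Closure.ReflexiveTransitive using (Star)
open import Relation.Binary.Core using (Rel)
import Relation.Binary.Definitions as B
open import Relation.Binary.PropositionalEquality
  using (_≡_; refl; sym; trans)
open import Relation.Nullary using (¬_; Dec)
open import Relation.Nullary.Decidable using (True; toWitness; _×-dec_; _⊎-dec_)
open import Relation.Unary using (Pred)

private
  variable
    c ℓ₁ ℓ₂ : Level
    m n : ℕ

record SimpleGraph (n : ℕ) : Set₁ where
  field
    Adj    : Rel (Fin n) 0ℓ
    symm   : B.Symmetric Adj
    irrefl : ∀ {v} → ¬ Adj v v
    adj?   : B.Decidable Adj

open SimpleGraph public

Connected : SimpleGraph n → Set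
Connected G = ∀ u v → Star (Adj G) u v

deg : SimpleGraph n → Fin n → ℕ
deg {n} G v = List.length (filter (adj? G v) (allFin n))

-- `min` takes a default value for the empty list.  Every degree is below
-- n, so the default n never matters unless n = 0, when δ G is 0.
δ : SimpleGraph n → ℕ
δ {n} G = min n (map (deg G) (allFin n))

infix 4 _≅_

_≅_ : SimpleGraph m → SimpleGraph n → Set
_≅_ {m} {n} G H =
  Σ[ π ∈ Permutation m n ] (∀ u v → Adj G u v ⇔ Adj H (π ⟨$⟩ʳ u) (π ⟨$⟩ʳ v))

private
  no-fixpoint : ∀ n .{{_ : NonZero n}} → 3 ≤ n → ∀ {i} → i < n → ¬ (i ≡ suc i % n)
  no-fixpoint n 3≤n {i} i<n eq with ℕ.m≤n⇒m<n∨m≡n i<n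
  ... | inj₁ 1+i<n = ℕ.1+n≢n (sym (trans eq (m<n⇒m%n≡m 1+i<n)))
  ... | inj₂ refl with trans eq (n%n≡0 n)
  ...   | refl with 3≤n
  ...     | s≤s ()

C : ∀ n .{{_ : NonZero n}} {_ : True (3 ℕ.≤? n)} → SimpleGraph n
C n {3≤n} = record
  { Adj    = λ i j → Succ i j ⊎ Succ j i
  ; symm   = Sum.swap
  ; irrefl = λ {v} → [ irr v , irr v ]′
  ; adj?   = λ i j → (toℕ j ℕ.≟ suc (toℕ i) % n) ⊎-dec (toℕ i ℕ.≟ suc (toℕ j) % n)
  }
  where
  Succ : Rel (Fin n) 0ℓ
  Succ i j = toℕ j ≡ suc (toℕ i) % n

  irr : ∀ v → ¬ Succ v v
  irr v = no-fixpoint n (toWitness 3≤n) (Fin.toℕ<n v)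

TotalDominating : SimpleGraph n → Subset n → Set
TotalDominating G D = ∀ v → ∃[ u ] (u ∈ D × Adj G v u)

totalDominating? : (G : SimpleGraph n) (D : Subset n) → Dec (TotalDominating G D)
totalDominating? G D = Fin.all? λ v → Fin.any? λ u → (u ∈? D) ×-dec adj? G v u

subsets : ∀ n → List (Subset n)
subsets 0       = [] List.∷ List.[]
subsets (suc n) = map (outside ∷_) (subsets n) ++ map (inside ∷_) (subsets n)

dₜ : SimpleGraph n → ℕ → ℕ
dₜ {n} G i =
  List.length (filter (λ D → totalDominating? G D ×-dec (∣ D ∣ ℕ.≟ i)) (subsets n))

-- A polynomial is its vector of coefficients, the entry at index i being
-- the coefficient of xⁱ.
Dₜ : SimpleGraph n → Vector ℕ (suc n)
Dₜ G i = dₜ G (toℕ i)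

module Polynomial (F : HeytingField c ℓ₁ ℓ₂) where
  open HeytingField F using (Carrier; _≈_; _*_; 0#; 1#; heytingCommutativeRing)
  open HeytingCommutativeRing heytingCommutativeRing using (commutativeRing)
  open RawSemiringDefs (Semiring.rawSemiring (CommutativeRing.semiring commutativeRing))
    using (sum; _^_) renaming (_×_ to _·_)

  fromNat : ℕ → Carrier
  fromNat k = k · 1#

  eval : Vector Carrier n → Carrier → Carrier
  eval p z = sum (λ i → p i * z ^ toℕ i)

  IsRoot : Vector Carrier n → Carrier → Set ℓ₁
  IsRoot p z = eval p z ≈ 0#

-- The complex numbers enter as an arbitrary algebraically closed field of
-- characteristic zero.  Equality need not be decidable, so that the
-- constructive complex numbers are an instance; classically a Heyting
-- field is just a field, with _#_ the negation of _≈_.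
record AlgebraicallyClosedField₀ c ℓ₁ ℓ₂ : Set (lsuc (c ⊔ ℓ₁ ⊔ ℓ₂)) where
  field
    heytingField : HeytingField c ℓ₁ ℓ₂

  open HeytingField heytingField public
  open Polynomial heytingField public

  field
    characteristicZero  : ∀ k → ¬ (fromNat (suc k) ≈ 0#)
    algebraicallyClosed : ∀ d (p : Vector Carrier (suc (suc d))) →
                          Vector.last p # 0# → ∃[ z ] IsRoot p z

module _ (K : AlgebraicallyClosedField₀ c ℓ₁ ℓ₂) where
  open AlgebraicallyClosedField₀ K

  Z : Vector ℕ n → Pred Carrier ℓ₁
  Z p = IsRoot (Vector.map fromNat p)

  -- The set {-3, 0}.  "Or" is doubly negated because, without decidable
  -- equality, a product being zero does not say which factor is zero.
  -- With decidable equality this is plain z ≈ -3 ⊎ z ≈ 0.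
  ｛-3,0｝ : Pred Carrier ℓ₁
  ｛-3,0｝ z = ¬ ¬ (z ≈ - fromNat 3 ⊎ z ≈ 0#)

module Submission where

-- If all roots are 0 or -3, then Dₜ G = xᵃ (x + 3)ᵇ with a + b = n, so dₜ G (n - i) = (b choose i) 3ⁱ.  Since every degree
-- is at least 2, the coefficient of xⁿ⁻¹ is n, whence n = 3b, and the coefficient of xⁿ⁻² leaves exactly n sets of size
-- n - 2 that are not total dominating.  Their complements are the neighbourhoods of size 2, so every vertex has degree 2
-- and distinct vertices have distinct neighbourhoods.  Moreover every total dominating set has at least a = 2n/3
-- elements; equivalently, at most n/3 vertices can be pairwise without a common neighbour.  In the graph "having a
-- common neighbour" all degrees are at most 2, so a greedy packing would exceed n/3 unless that relation is transitive,
-- and this closes a walk of five vertices into a triangle or a hexagon.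

open import Defs
open import Algebra.Apartness.Bundles using (HeytingCommutativeRing)
import Algebra.Apartness.Properties.HeytingCommutativeRing as Heyting
open import Algebra.Bundles using (CommutativeRing; Semiring)
import Algebra.Properties.CommutativeMonoid.Sum as MonoidSum
import Algebra.Properties.Group as GroupProperties
import Algebra.Properties.Ring as RingProperties
import Algebra.Properties.Semiring.Mult as Mult
import Algebra.Properties.Semiring.Sum as Sum
import Algebra.Solver.Ring.NaturalCoefficients.Default as SemiringSolver
open import Data.Fin.Base as Fin using (Fin; zero; suc; toℕ; fromℕ<)
open import Data.Fin.Patterns using (0F; 1F; 2F; 3F; 4F; 5F)
open import Data.Fin.Permutation using (Permutation; permutation; _⟨$⟩ʳ_; _⟨$⟩ˡ_; flip; inverseˡ; inverseʳ; ↔⇒≡)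
import Data.Fin.Properties as Fin
open import Data.List.Base using (List; []; _∷_; _++_; length; map; filter; allFin; lookup)
open import Data.List.Extrema.Nat using (min≤xs; min≤⊤)
open import Data.List.Membership.Propositional using (lose; find) renaming (_∈_ to _∈ˡ_; _∉_ to _∉ˡ_)
open import Data.List.Membership.Propositional.Properties
  using (∈-lookup; ∈-map⁺; ∈-map⁻; ∈-++⁺ˡ; ∈-++⁺ʳ; ∈-filter⁺; ∈-filter⁻; ∈-allFin; ∈-length)
import Data.List.Membership.Setoid.Properties as SetoidMembership
open import Data.List.Properties
  using (filter-++; filter-none; filter-notAll; filter-≐; length-++; length-tabulate)
open import Data.List.Relation.Unary.All as All using (All; []; _∷_)
import Data.List.Relation.Unary.All.Properties as All
open import Data.List.Relation.Unary.AllPairs using ([]; _∷_)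
open import Data.List.Relation.Unary.Any as Any using (here; there; index)
open import Data.List.Relation.Unary.Unique.Propositional using (Unique)
import Data.List.Relation.Unary.Unique.Propositional.Properties as Unique
open import Data.Nat.Base as ℕ using (ℕ; zero; suc; _≤_; _<_; _∸_; z≤n; s≤s)
open import Data.Nat.Combinatorics
  using (nCk≡nC[n∸k]; nCk+nC[k+1]≡[n+1]C[k+1]; k>n⇒nCk≡0; nC1≡n; nCn≡1)
  renaming (_C_ to _choose_)
open import Data.Nat.DivMod using (_%_)
import Data.Nat.Properties as ℕ
open import Data.Nat.Tactic.RingSolver using (solve-∀)
open import Data.Product.Base using (_×_; _,_; ∃₂; ∃-syntax; proj₁; proj₂)
open import Data.Sum.Base as ⊎ using (_⊎_; inj₁; inj₂; [_,_]′)
open import Data.Vec.Base as Vec using ([]; _∷_)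
import Data.Vec.Properties as Vec
open import Function.Base using (_∘_; id)
open import Function.Bundles using (Equivalence; _⇔_; mk⇔)
open import Level using (Level)
open import Relation.Binary.Construct.Closure.ReflexiveTransitive using (Star; ε; _◅_)
open import Relation.Binary.Core using (REL)
open import Relation.Binary.PropositionalEquality as ≡ using (_≡_; _≢_; cong; cong₂; subst; ≢-sym; module ≡-Reasoning)
import Relation.Binary.Reasoning.Setoid as SetoidReasoning
open import Relation.Nullary using (¬_; Dec; yes; no; contradiction; ¬?)
open import Relation.Nullary.Decidable using (_×-dec_; _→-dec_; decidable-stable)
open import Relation.Unary using (Pred; Decidable; _≐_) renaming (_⊆_ to _⊆ᵤ_)

private
  variable
    a b c ℓ ℓ₁ ℓ₂ : Level
    A : Set a
    B : Set b
    m n : ℕ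

-- Polynomials with roots 0 and -3

module Roots (K : AlgebraicallyClosedField₀ c ℓ₁ ℓ₂) where
  open AlgebraicallyClosedField₀ K
    using (heytingField; heytingCommutativeRing; fromNat; characteristicZero; algebraicallyClosed; tight)
  open HeytingCommutativeRing heytingCommutativeRing using (_#_; commutativeRing)
  open CommutativeRing commutativeRing hiding (zero)
  open Polynomial heytingField using (eval)
  open Mult semiring using (×-homo-+; ×1-homo-*)
  open Sum semiring using (sum; sum-cong-≋; *-distribˡ-sum)
  open RingProperties ring using (-0#≈0#; +-cancelˡ)
  open GroupProperties +-group using (inverseˡ-unique)
  open Heyting heytingCommutativeRing using (1#0; #-congʳ; x#0y#0→xy#0)
  open import Algebra.Definitions.RawSemiring (Semiring.rawSemiring semiring) using (_^_)
  open SetoidReasoning setoid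
  open SemiringSolver commutativeSemiring using (solve; _:+_; _:*_; _:=_; con)

  -- Coefficients are functions on all of ℕ, read only up to the degree bound `d`, so that tails and
  -- quotients need no index casts.
  horner : ℕ → (ℕ → Carrier) → Carrier → Carrier
  horner zero    p z = p 0
  horner (suc d) p z = p 0 + z * horner d (p ∘ suc) z

  horner-cong : ∀ d p {y z} → y ≈ z → horner d p y ≈ horner d p z
  horner-cong zero    p y≈z = refl
  horner-cong (suc d) p y≈z = +-congˡ (*-cong y≈z (horner-cong d (p ∘ suc) y≈z))

  eval≈horner : ∀ d p z → eval {suc d} (p ∘ toℕ) z ≈ horner d p z
  eval≈horner zero    p z = trans (+-identityʳ _) (*-identityʳ _)
  eval≈horner (suc d) p z = +-cong (*-identityʳ _) (begin
    sum {suc d} (λ i → p (suc (toℕ i)) * (z * z ^ toℕ i))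
      ≈⟨ sum-cong-≋ {suc d} (λ i → lemma (p (suc (toℕ i))) z (z ^ toℕ i)) ⟩
    sum {suc d} (λ i → z * (p (suc (toℕ i)) * z ^ toℕ i))
      ≈⟨ *-distribˡ-sum z (λ (i : Fin (suc d)) → p (suc (toℕ i)) * z ^ toℕ i) ⟨
    z * eval {suc d} (p ∘ suc ∘ toℕ) z
      ≈⟨ *-congˡ (eval≈horner d (p ∘ suc) z) ⟩
    z * horner d (p ∘ suc) z ∎)
    where
    lemma : ∀ a b c → a * (b * c) ≈ b * (a * c)
    lemma = solve 3 (λ a b c → a :* (b :* c) := b :* (a :* c)) refl

  -- Synthetic division by x - r: the quotient's coefficients are the Horner values at r of the tails of p.
  quotient : ℕ → (ℕ → Carrier) → Carrier → ℕ → Carrier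
  quotient zero    p r i       = 0#
  quotient (suc d) p r zero    = horner d (p ∘ suc) r
  quotient (suc d) p r (suc i) = quotient d (p ∘ suc) r i

  quotient-zero : ∀ d p r → quotient d p r d ≈ 0#
  quotient-zero zero    p r = refl
  quotient-zero (suc d) p r = quotient-zero d (p ∘ suc) r

  -- Horner's recursion unfolded once. At the top, where `suc j` is `d`, the next entry of the
  -- quotient is its zero padding.
  quotient-coefficient : ∀ {d j} p r → j < d →
    quotient d p r j ≈ p (suc j) + r * quotient d p r (suc j)
  quotient-coefficient {suc zero}    {zero}  p r _         = sym (trans (+-congˡ (zeroʳ r)) (+-identityʳ _))
  quotient-coefficient {suc (suc d)} {zero}  p r _         = refl
  quotient-coefficient {suc d}       {suc j} p r (s≤s j<d) = quotient-coefficient (p ∘ suc) r j<d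

  -- The difference z - r enters as a variable `w`: division with remainder then involves no
  -- subtraction, and the semiring solver applies.
  horner-quotient : ∀ d p {r w z} → z ≈ w + r →
    horner (suc d) p z ≈ horner (suc d) p r + w * horner d (quotient (suc d) p r) z
  horner-quotient zero p {r} {w} {z} z≈w+r = begin
    p 0 + z * p 1                ≈⟨ +-congˡ (*-congʳ z≈w+r) ⟩
    p 0 + (w + r) * p 1          ≈⟨ lemma (p 0) (p 1) r w ⟩
    p 0 + r * p 1 + w * p 1      ∎
    where
    lemma : ∀ a b r w → a + (w + r) * b ≈ a + r * b + w * b
    lemma = solve 4 (λ a b r w → a :+ (w :+ r) :* b := a :+ r :* b :+ w :* b) refl
  horner-quotient (suc d) p {r} {w} {z} z≈w+r = begin
    p 0 + z * horner (suc d) (p ∘ suc) z          ≈⟨ +-congˡ (*-cong z≈w+r (horner-quotient d (p ∘ suc) z≈w+r)) ⟩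
    p 0 + (w + r) * (h + w * horner d q z)        ≈⟨ lemma (p 0) h (horner d q z) r w ⟩
    p 0 + r * h + w * (h + (w + r) * horner d q z)
      ≈⟨ +-congˡ (*-congˡ (+-congˡ (*-congʳ z≈w+r))) ⟨
    p 0 + r * h + w * (h + z * horner d q z)      ∎
    where
    h = horner (suc d) (p ∘ suc) r
    q = quotient (suc d) (p ∘ suc) r
    lemma : ∀ a b q r w → a + (w + r) * (b + w * q) ≈ a + r * b + w * (b + (w + r) * q)
    lemma = solve 5 (λ a b q r w → a :+ (w :+ r) :* (b :+ w :* q) := a :+ r :* b :+ w :* (b :+ (w :+ r) :* q)) refl

  cancel : ∀ a s b → a ≈ a + (- s) * b + s * b
  cancel a s b = begin
    a                        ≈⟨ +-identityʳ a ⟨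
    a + 0#                   ≈⟨ +-congˡ (zeroˡ b) ⟨
    a + 0# * b               ≈⟨ +-congˡ (*-congʳ (-‿inverseˡ s)) ⟨
    a + (- s + s) * b        ≈⟨ +-congˡ (distribʳ b (- s) s) ⟩
    a + ((- s) * b + s * b)  ≈⟨ +-assoc a _ _ ⟨
    a + (- s) * b + s * b    ∎

  z≈z+s-s : ∀ z s → z ≈ z + s - s
  z≈z+s-s z s = begin
    z             ≈⟨ +-identityʳ z ⟨
    z + 0#        ≈⟨ +-congˡ (-‿inverseʳ s) ⟨
    z + (s - s)   ≈⟨ +-assoc z s (- s) ⟨
    z + s - s     ∎

  fromNat-injective : ∀ {m n} → fromNat m ≈ fromNat n → m ≡ n
  fromNat-injective {zero}  {zero}  _  = ≡.refl
  fromNat-injective {zero}  {suc n} eq with () ← characteristicZero n (sym eq)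
  fromNat-injective {suc m} {zero}  eq with () ← characteristicZero m eq
  fromNat-injective {suc m} {suc n} eq = cong suc (fromNat-injective (+-cancelˡ 1# _ _ eq))

  RootsIn-3,0 : ℕ → (ℕ → Carrier) → Set _
  RootsIn-3,0 d p = ∀ z → horner d p z ≈ 0# → ｛-3,0｝ K z

  -- The coefficients of p = xᵃ (x + 3)ᵇ with a + b = d, read off from the top.
  Factors : ℕ → ℕ → (ℕ → Carrier) → Set _
  Factors b d p = ∀ i j → i ℕ.+ j ≡ d → p j ≈ fromNat ((b choose i) ℕ.* 3 ℕ.^ i)

  -- The root is written `- s`, so that comparing coefficients in p = (x + s) q gives formulas
  -- without signs; `s` is later 0 or 3.
  module _ (d : ℕ) (p : ℕ → Carrier) {s : Carrier} (p-r≈0 : horner (suc d) p (- s) ≈ 0#) where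
    private
      q = quotient (suc d) p (- s)

    quotient-root : ∀ {z} → horner d q z ≈ 0# → horner (suc d) p z ≈ 0#
    quotient-root {z} qz≈0 = begin
      horner (suc d) p z                                      ≈⟨ horner-quotient d p (z≈z+s-s z s) ⟩
      horner (suc d) p (- s) + (z + s) * horner d q z       ≈⟨ +-cong p-r≈0 (*-congˡ qz≈0) ⟩
      0# + (z + s) * 0#                                     ≈⟨ +-identityˡ _ ⟩
      (z + s) * 0#                                          ≈⟨ zeroʳ _ ⟩
      0#                                                      ∎

    coefficient-zero : p 0 ≈ s * q 0
    coefficient-zero = begin
      p 0                                   ≈⟨ cancel (p 0) s (q 0) ⟩
      p 0 + (- s) * q 0 + s * q 0           ≈⟨ +-congʳ p-r≈0 ⟩
      0# + s * q 0                          ≈⟨ +-identityˡ _ ⟩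
      s * q 0                               ∎

    coefficient-suc : ∀ {j} → j ≤ d → p (suc j) ≈ q j + s * q (suc j)
    coefficient-suc {j} j≤d = begin
      p (suc j)                                       ≈⟨ cancel (p (suc j)) s (q (suc j)) ⟩
      p (suc j) + (- s) * q (suc j) + s * q (suc j)   ≈⟨ +-congʳ (quotient-coefficient p (- s) (s≤s j≤d)) ⟨
      q j + s * q (suc j)                             ∎

    quotient-monic : p (suc d) ≈ 1# → q d ≈ 1#
    quotient-monic monic = begin
      q d                  ≈⟨ +-identityʳ _ ⟨
      q d + 0#             ≈⟨ +-congˡ (zeroʳ s) ⟨
      q d + s * 0#         ≈⟨ +-congˡ (*-congˡ (quotient-zero (suc d) p (- s))) ⟨
      q d + s * q (suc d)  ≈⟨ coefficient-suc ℕ.≤-refl ⟨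
      p (suc d)            ≈⟨ monic ⟩
      1#                   ∎

  fromNat≡ : ∀ {m n} → m ≡ n → fromNat m ≈ fromNat n
  fromNat≡ ≡.refl = refl

  -- Multiplication by x does not change coefficients counted from the top. The new constant
  -- coefficient has i = d + 1 > b, where the binomial vanishes.
  factors-x : ∀ {b d p} → b ≤ d → (p0≈0 : horner (suc d) p (- 0#) ≈ 0#) →
              Factors b d (quotient (suc d) p (- 0#)) → Factors b (suc d) p
  factors-x {b} {d} {p} b≤d p0≈0 fac i zero i+0≡1+d = begin
    p 0                              ≈⟨ coefficient-zero d p p0≈0 ⟩
    0# * _                           ≈⟨ zeroˡ _ ⟩
    0#                               ≈⟨ fromNat≡ (cong (ℕ._* 3 ℕ.^ i) (k>n⇒nCk≡0 b<i)) ⟨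
    fromNat ((b choose i) ℕ.* 3 ℕ.^ i)    ∎
    where
    b<i : b < i
    b<i = ℕ.<-≤-trans (s≤s b≤d) (ℕ.≤-reflexive (≡.trans (≡.sym i+0≡1+d) (ℕ.+-identityʳ i)))
  factors-x {b} {d} {p} b≤d p0≈0 fac i (suc j) i+1+j≡1+d = begin
    p (suc j)                          ≈⟨ coefficient-suc d p p0≈0 j≤d ⟩
    q j + 0# * q (suc j)               ≈⟨ +-congˡ (zeroˡ _) ⟩
    q j + 0#                           ≈⟨ +-identityʳ _ ⟩
    q j                                ≈⟨ fac i j i+j≡d ⟩
    fromNat ((b choose i) ℕ.* 3 ℕ.^ i)      ∎
    where
    q = quotient (suc d) p (- 0#)
    i+j≡d : i ℕ.+ j ≡ d
    i+j≡d = ℕ.suc-injective (≡.trans (≡.sym (ℕ.+-suc i j)) i+1+j≡1+d)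
    j≤d : j ≤ d
    j≤d = subst (j ≤_) i+j≡d (ℕ.m≤n+m j i)

  -- Pascal's rule scaled by a power of 3: the recurrence of the coefficients under multiplication
  -- by x + 3.
  binomial-step : ∀ b i →
    (b choose suc i) ℕ.* 3 ℕ.^ suc i ℕ.+ 3 ℕ.* ((b choose i) ℕ.* 3 ℕ.^ i) ≡ (suc b choose suc i) ℕ.* 3 ℕ.^ suc i
  binomial-step b i = ≡.trans (lemma (b choose suc i) (b choose i) (3 ℕ.^ i))
    (cong (ℕ._* 3 ℕ.^ suc i) (nCk+nC[k+1]≡[n+1]C[k+1] b i))
    where
    lemma : ∀ x y z → x ℕ.* (3 ℕ.* z) ℕ.+ 3 ℕ.* (y ℕ.* z) ≡ (y ℕ.+ x) ℕ.* (3 ℕ.* z)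
    lemma = solve-∀

  factors-x+3 : ∀ {b d p} → b ≤ d → p (suc d) ≈ 1# →
                (p-3≈0 : horner (suc d) p (- fromNat 3) ≈ 0#) →
                Factors b d (quotient (suc d) p (- fromNat 3)) → Factors (suc b) (suc d) p
  factors-x+3 {b} {d} {p} b≤d monic p-3≈0 fac (suc i) zero i+0≡1+d = begin
    p 0                                           ≈⟨ coefficient-zero d p p-3≈0 ⟩
    fromNat 3 * quotient (suc d) p (- fromNat 3) 0 ≈⟨ *-congˡ (fac i 0 (ℕ.suc-injective i+0≡1+d)) ⟩
    fromNat 3 * fromNat ((b choose i) ℕ.* 3 ℕ.^ i)     ≈⟨ ×1-homo-* 3 ((b choose i) ℕ.* 3 ℕ.^ i) ⟨
    fromNat (3 ℕ.* ((b choose i) ℕ.* 3 ℕ.^ i))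
      -- Since i + 1 > b, the term with `b choose suc i` is zero; inserting it lets `binomial-step`
      -- apply to the constant coefficient as well.
      ≈⟨ fromNat≡ (cong (λ k → k ℕ.* 3 ℕ.^ suc i ℕ.+ 3 ℕ.* ((b choose i) ℕ.* 3 ℕ.^ i)) (k>n⇒nCk≡0 b<1+i)) ⟨
    fromNat ((b choose suc i) ℕ.* 3 ℕ.^ suc i ℕ.+ 3 ℕ.* ((b choose i) ℕ.* 3 ℕ.^ i))
      ≈⟨ fromNat≡ (binomial-step b i) ⟩
    fromNat ((suc b choose suc i) ℕ.* 3 ℕ.^ suc i)     ∎
    where
    b<1+i : b < suc i
    b<1+i = ℕ.≤-trans (s≤s b≤d) (ℕ.≤-reflexive (≡.trans (≡.sym i+0≡1+d) (ℕ.+-identityʳ (suc i))))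
  -- The leading coefficient. In this clause the names of the first two arguments are interchanged:
  -- `b≤d` is the proof that `p` is monic.
  factors-x+3 monic b≤d p-3≈0 fac zero    (suc j) ≡.refl = trans b≤d (sym (+-identityʳ 1#))
  factors-x+3 {b} {d} {p} b≤d monic p-3≈0 fac (suc i) (suc j) i+j≡d = begin
    p (suc j)                                     ≈⟨ coefficient-suc d p p-3≈0 j≤d ⟩
    q j + fromNat 3 * q (suc j)
      ≈⟨ +-cong (fac (suc i) j i+1+j≡d) (*-congˡ (fac i (suc j) (ℕ.suc-injective i+j≡d))) ⟩
    fromNat ((b choose suc i) ℕ.* 3 ℕ.^ suc i) + fromNat 3 * fromNat ((b choose i) ℕ.* 3 ℕ.^ i)
      ≈⟨ +-congˡ (×1-homo-* 3 ((b choose i) ℕ.* 3 ℕ.^ i)) ⟨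
    fromNat ((b choose suc i) ℕ.* 3 ℕ.^ suc i) + fromNat (3 ℕ.* ((b choose i) ℕ.* 3 ℕ.^ i))
      ≈⟨ ×-homo-+ 1# ((b choose suc i) ℕ.* 3 ℕ.^ suc i) _ ⟨
    fromNat ((b choose suc i) ℕ.* 3 ℕ.^ suc i ℕ.+ 3 ℕ.* ((b choose i) ℕ.* 3 ℕ.^ i))
      ≈⟨ fromNat≡ (binomial-step b i) ⟩
    fromNat ((suc b choose suc i) ℕ.* 3 ℕ.^ suc i)     ∎
    where
    q = quotient (suc d) p (- fromNat 3)
    i+1+j≡d : suc i ℕ.+ j ≡ d
    i+1+j≡d = ≡.trans (≡.sym (ℕ.+-suc i j)) (ℕ.suc-injective i+j≡d)
    j≤d : j ≤ d
    j≤d = subst (j ≤_) i+1+j≡d (ℕ.m≤n+m j (suc i))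

  -- One root is split off at a time: algebraic closure supplies it, and the roots of the quotient
  -- are again roots of `p`. Whether it is 0 or -3 is known only under a double negation, which the
  -- conclusion inherits.
  factorization : ∀ d p → p d ≈ 1# → RootsIn-3,0 d p → ¬ ¬ (∃[ b ] (b ≤ d × Factors b d p))
  factorization zero p monic roots k =
    k (0 , z≤n , λ { zero zero ≡.refl → trans monic (sym (+-identityʳ 1#)) })
  factorization (suc d) p monic roots k
    with z , pz≈0 ← algebraicallyClosed d (p ∘ toℕ)
           (#-congʳ (sym (trans (reflexive (cong p (Fin.toℕ-fromℕ (suc d)))) monic)) 1#0) =
    roots z (root pz≈0) λ
      { (inj₁ z≈-3) → let p-3≈0 = trans (horner-cong (suc d) p (sym z≈-3)) (root pz≈0) in
          descend p-3≈0 λ (b , b≤d , fac) → k (suc b , s≤s b≤d , factors-x+3 {p = p} b≤d monic p-3≈0 fac)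
      ; (inj₂ z≈0)  → let p0≈0 = trans (horner-cong (suc d) p (trans -0#≈0# (sym z≈0))) (root pz≈0) in
          descend p0≈0 λ (b , b≤d , fac) → k (b , ℕ.m≤n⇒m≤1+n b≤d , factors-x {p = p} b≤d p0≈0 fac) }
    where
    root : ∀ {z} → eval {suc (suc d)} (p ∘ toℕ) z ≈ 0# → horner (suc d) p z ≈ 0#
    root {z} = trans (sym (eval≈horner (suc d) p z))

    descend : ∀ {s} → horner (suc d) p (- s) ≈ 0# →
              ¬ ¬ (∃[ b ] (b ≤ d × Factors b d (quotient (suc d) p (- s))))
    descend {s} p-s≈0 = factorization d (quotient (suc d) p (- s)) (quotient-monic d p p-s≈0 monic)
      λ z qz≈0 → roots z (quotient-root d p p-s≈0 qz≈0)

  -- With `b` and `j` ranging over `Fin (suc n)` the claim is a bounded statement about natural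
  -- numbers, hence decidable, and the double negation of `factorization` can be removed.
  -- Characteristic zero brings the coefficients back to ℕ.
  binomial-coefficients : ∀ n (f : ℕ → ℕ) → f n ≡ 1 → Z K {suc n} (f ∘ toℕ) ⊆ᵤ ｛-3,0｝ K →
    ∃[ b ] ∀ i j → i ℕ.+ j ≡ n → f j ≡ (b choose i) ℕ.* 3 ℕ.^ i
  binomial-coefficients n f fn≡1 roots
    with b , fac ← decidable-stable
           (Fin.any? λ b → Fin.all? λ j → f (toℕ j) ℕ.≟ (toℕ b choose (n ∸ toℕ j)) ℕ.* 3 ℕ.^ (n ∸ toℕ j))
           (λ k → factorization n (fromNat ∘ f) (trans (fromNat≡ fn≡1) (+-identityʳ 1#))
             (λ z pz≈0 → roots (trans (eval≈horner n (fromNat ∘ f) z) pz≈0))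
             λ (b , b≤n , fac) → k (fromℕ< (s≤s b≤n) , λ j → fromNat-injective
               (subst (λ m → fromNat (f (toℕ j)) ≈ fromNat ((m choose (n ∸ toℕ j)) ℕ.* 3 ℕ.^ (n ∸ toℕ j)))
                 (≡.sym (Fin.toℕ-fromℕ< (s≤s b≤n)))
                 (fac (n ∸ toℕ j) (toℕ j) (ℕ.m∸n+n≡m (ℕ.s≤s⁻¹ (Fin.toℕ<n j)))))))
    = toℕ b , λ { i j ≡.refl →
        let j<1+n = s≤s (ℕ.m≤n+m j i)
        in subst (λ k → f j ≡ (toℕ b choose k) ℕ.* 3 ℕ.^ k) (ℕ.m+n∸n≡m i j)
             (subst (λ k → f k ≡ (toℕ b choose (i ℕ.+ j ∸ k)) ℕ.* 3 ℕ.^ (i ℕ.+ j ∸ k))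
               (Fin.toℕ-fromℕ< j<1+n) (fac (fromℕ< j<1+n))) }

  -- The root sets of the triangle and the hexagon

  -- By tightness a nonzero factor is not not apart from zero, and two factors apart from zero have
  -- a product apart from zero.
  zero-product : ∀ {x y} → x * y ≈ 0# → ¬ ¬ (x ≈ 0# ⊎ y ≈ 0#)
  zero-product {x} {y} xy≈0 k =
    ≉⇒¬¬# (k ∘ inj₁) λ x#0 → ≉⇒¬¬# (k ∘ inj₂) λ y#0 →
      proj₂ (tight _ _) xy≈0 (x#0y#0→xy#0 x#0 y#0)
    where
    ≉⇒¬¬# : ∀ {x} → ¬ (x ≈ 0#) → ¬ ¬ (x # 0#)
    ≉⇒¬¬# x≉0 ¬x#0 = x≉0 (proj₁ (tight _ _) ¬x#0)

  horner-coefficients : ∀ d {p q} z → (∀ j → p j ≈ q j) → horner d p z ≈ horner d q z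
  horner-coefficients zero    z p≈q = p≈q 0
  horner-coefficients (suc d) z p≈q = +-cong (p≈q 0) (*-congˡ (horner-coefficients d z (p≈q ∘ suc)))

  -- Tightness makes equality a negation. Equations may therefore be proved by cases on the doubly
  -- negated `｛-3,0｝`.
  ≈-stable : ∀ {x y} → ¬ ¬ (x ≈ y) → x ≈ y
  ≈-stable ¬¬x≈y = proj₁ (tight _ _) λ x#y → ¬¬x≈y λ x≈y → proj₂ (tight _ _) x≈y x#y

  -- The total domination polynomial of the triangle. That of the hexagon is its square, because the
  -- neighbourhoods in the hexagon are the pairs of even and the pairs of odd vertices, as in two
  -- separate triangles.
  cubic : Carrier → Carrier
  cubic z = z * (z * (z + fromNat 3))

  cubic-roots : ∀ {z} → cubic z ≈ 0# → ｛-3,0｝ K z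
  cubic-roots cubic≈0 k = zero-product cubic≈0
    [ k ∘ inj₂ , (λ z[z+3]≈0 → zero-product z[z+3]≈0 [ k ∘ inj₂ , k ∘ inj₁ ∘ inverseˡ-unique _ _ ]′) ]′

  roots-cubic : ∀ {z} → ｛-3,0｝ K z → cubic z ≈ 0#
  roots-cubic {z} z∈ = ≈-stable λ k → z∈
    [ (λ z≈-3 → k (trans (*-congˡ (trans (*-congˡ (trans (+-congʳ z≈-3) (-‿inverseˡ _))) (zeroʳ z))) (zeroʳ z)))
    , (λ z≈0 → k (trans (*-congʳ z≈0) (zeroˡ _))) ]′

  -- The counts `dₜ (C 3) j` evaluate to 0, 0, 3, 1 by normalisation, leaving a semiring identity.
  C₃-cubic : ∀ z → horner 3 (fromNat ∘ dₜ (C 3)) z ≈ cubic z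
  C₃-cubic z = solve 2 (λ z t → con 0 :+ z :* (con 0 :+ z :* (t :+ z :* (con 1 :+ con 0))) := z :* (z :* (z :+ t)))
    refl z (fromNat 3)

  C₆-cubic² : ∀ z → horner 6 (fromNat ∘ dₜ (C 6)) z ≈ cubic z * cubic z
  C₆-cubic² z = begin
    horner 6 (fromNat ∘ dₜ (C 6)) z
      -- The coefficients 9 and 6 become 3 * 3 and 3 + 3, since the solver treats `fromNat 3` as a
      -- variable.
      ≈⟨ +-congˡ (*-congˡ (+-congˡ (*-congˡ (+-congˡ (*-congˡ (+-congˡ (*-congˡ (+-cong (×1-homo-* 3 3) (*-congˡ (+-congʳ (×-homo-+ 1# 3 3)))))))))))  ⟩
    0# + z * (0# + z * (0# + z * (0# + z * (t * t + z * (t + t + z * (1# + 0#))))))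
      ≈⟨ solve 2 (λ z t → con 0 :+ z :* (con 0 :+ z :* (con 0 :+ z :* (con 0 :+ z :* (t :* t :+ z :* (t :+ t :+ z :* (con 1 :+ con 0))))))
           := z :* (z :* (z :+ t)) :* (z :* (z :* (z :+ t)))) refl z t ⟩
    cubic z * cubic z ∎
    where t = fromNat 3

  module _ (n : ℕ) (f : ℕ → ℕ) {g : ℕ → ℕ} (f≗g : ∀ j → f j ≡ g j) where

    Z-≐ : (∀ {z} → horner n (fromNat ∘ g) z ≈ 0# → ｛-3,0｝ K z) →
          (∀ {z} → ｛-3,0｝ K z → horner n (fromNat ∘ g) z ≈ 0#) →
          Z K {suc n} (f ∘ toℕ) ≐ ｛-3,0｝ K
    Z-≐ roots⇒ roots⇐ = (λ fz≈0 → roots⇒ (trans (sym (eval≈ _)) fz≈0)) , (λ z∈ → trans (eval≈ _) (roots⇐ z∈))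
      where
      eval≈ : ∀ z → eval {suc n} (fromNat ∘ f ∘ toℕ) z ≈ horner n (fromNat ∘ g) z
      eval≈ z = trans (eval≈horner n (fromNat ∘ f) z) (horner-coefficients n z (fromNat≡ ∘ f≗g))

  C₃-roots : ∀ f → (∀ j → f j ≡ dₜ (C 3) j) → Z K {4} (f ∘ toℕ) ≐ ｛-3,0｝ K
  C₃-roots f f≗ = Z-≐ 3 f f≗
    (λ {z} z≈0 → cubic-roots (trans (sym (C₃-cubic z)) z≈0))
    (λ {z} z∈ → trans (C₃-cubic z) (roots-cubic z∈))

  C₆-roots : ∀ f → (∀ j → f j ≡ dₜ (C 6) j) → Z K {7} (f ∘ toℕ) ≐ ｛-3,0｝ K
  C₆-roots f f≗ = Z-≐ 6 f f≗
    (λ {z} z≈0 → cubic-roots (≈-stable λ k → zero-product (trans (sym (C₆-cubic² z)) z≈0) [ k , k ]′))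
    (λ {z} z∈ → trans (C₆-cubic² z) (trans (*-congʳ (roots-cubic z∈)) (zeroˡ _)))

open import Data.Fin.Subset using (Subset; Side; inside; outside; _∈_; _∉_; ∣_∣; ∁; ⊤; _-_)
open import Data.Fin.Subset.Properties
  using (_∈?_; ∣p∣≤n; ∣∁p∣≡n∸∣p∣; ∣⊤∣≡n; ∈⊤; ⊆-antisym; x∉p⇒x∈∁p; x∈p∧x≢y⇒x∈p-y; x∈p⇒∣p-x∣<∣p∣)
open ≡ using (refl; sym; trans; setoid)
open MonoidSum ℕ.+-0-commutativeMonoid using (sum; sum-cong-≗; sum-permute)

-- Counting subsets

lookup-injective : ∀ {xs : List A} → Unique xs → ∀ {i j} → lookup xs i ≡ lookup xs j → i ≡ j
lookup-injective (_  ∷ _) {zero}  {zero}  _  = refl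
lookup-injective (x∉ ∷ _) {zero}  {suc j} eq = contradiction eq (All.lookup x∉ (∈-lookup j))
lookup-injective (x∉ ∷ _) {suc i} {zero}  eq = contradiction (sym eq) (All.lookup x∉ (∈-lookup i))
lookup-injective (_  ∷ u) {suc i} {suc j} eq = cong suc (lookup-injective u eq)

-- The pigeonhole principle on list positions. A relation replaces the function because an element
-- may have several images: a set can leave several vertices undominated.
length-injection : ∀ {xs : List A} {ys : List B} (R : REL A B ℓ) → Unique xs →
  (∀ {x} → x ∈ˡ xs → ∃[ y ] (y ∈ˡ ys × R x y)) →
  (∀ {x x′ y} → x ∈ˡ xs → x′ ∈ˡ xs → R x y → R x′ y → x ≡ x′) →
  length xs ≤ length ys
length-injection {xs = xs} {ys} R unique image injective = Fin.injective⇒≤ {f = f} f-injective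
  where
  f : Fin (length xs) → Fin (length ys)
  f i = index (proj₁ (proj₂ (image (∈-lookup i))))

  f-injective : ∀ {i j} → f i ≡ f j → i ≡ j
  f-injective {i} {j} eq
    with x , x∈ys , Rix ← image (∈-lookup {xs = xs} i)
       | y , y∈ys , Rjy ← image (∈-lookup {xs = xs} j)
    with refl ← SetoidMembership.index-injective (setoid _) x∈ys y∈ys eq
    = lookup-injective unique (injective (∈-lookup i) (∈-lookup j) Rix Rjy)

unique-⊆-length : ∀ {xs ys : List A} → Unique xs → (∀ {x} → x ∈ˡ xs → x ∈ˡ ys) → length xs ≤ length ys
unique-⊆-length unique sub =
  length-injection _≡_ unique (λ x∈xs → _ , sub x∈xs , refl) (λ _ _ x≡y x′≡y → trans x≡y (sym x′≡y))

length-allFin : ∀ n → length (allFin n) ≡ n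
length-allFin n = length-tabulate id

module _ {P : Pred A ℓ₁} {Q : Pred A ℓ₂} (P? : Decidable P) (Q? : Decidable Q) where

  length-filter-split : ∀ xs →
    length (filter (λ x → P? x ×-dec Q? x) xs) ℕ.+ length (filter (λ x → ¬? (P? x) ×-dec Q? x) xs)
      ≡ length (filter Q? xs)
  length-filter-split [] = refl
  length-filter-split (x ∷ xs) with P? x | Q? x
  ... | yes _ | yes _ = cong suc (length-filter-split xs)
  ... | yes _ | no  _ = length-filter-split xs
  ... | no  _ | yes _ = trans (ℕ.+-suc _ _) (cong suc (length-filter-split xs))
  ... | no  _ | no  _ = length-filter-split xs

length-filter-map : ∀ {P : Pred B ℓ} (P? : Decidable P) (f : A → B) xs →
  length (filter P? (map f xs)) ≡ length (filter (P? ∘ f) xs)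
length-filter-map P? f [] = refl
length-filter-map P? f (x ∷ xs) with P? (f x)
... | yes _ = cong suc (length-filter-map P? f xs)
... | no  _ = length-filter-map P? f xs

∈-subsets : ∀ (D : Subset n) → D ∈ˡ subsets n
∈-subsets []            = here refl
∈-subsets (outside ∷ D) = ∈-++⁺ˡ (∈-map⁺ (outside ∷_) (∈-subsets D))
∈-subsets (inside  ∷ D) = ∈-++⁺ʳ _ (∈-map⁺ (inside ∷_) (∈-subsets D))

subsets-unique : ∀ n → Unique (subsets n)
subsets-unique zero    = [] ∷ []
subsets-unique (suc n) = Unique.++⁺
  (Unique.map⁺ Vec.∷-injectiveʳ (subsets-unique n))
  (Unique.map⁺ Vec.∷-injectiveʳ (subsets-unique n))
  λ (∈out , ∈in) → case-disjoint (∈-map⁻ _ ∈out) (∈-map⁻ _ ∈in)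
  where
  case-disjoint : ∀ {D : Subset (suc n)} →
    ∃[ E ] (E ∈ˡ subsets n × D ≡ outside ∷ E) → ¬ (∃[ E ] (E ∈ˡ subsets n × D ≡ inside ∷ E))
  case-disjoint (_ , _ , refl) (_ , _ , ())

-- The two halves of `subsets (suc n)` are the two terms of Pascal's rule.
length-subsets-of-size : ∀ n k → length (filter (λ D → ∣ D ∣ ℕ.≟ k) (subsets n)) ≡ n choose k
length-subsets-of-size zero    zero    = refl
length-subsets-of-size zero    (suc k) = sym (k>n⇒nCk≡0 (s≤s (z≤n {k})))
length-subsets-of-size (suc n) k = begin
  length (filter (size≟ k) (map (outside ∷_) (subsets n) ++ map (inside ∷_) (subsets n)))
    ≡⟨ cong length (filter-++ (size≟ k) (map (outside ∷_) (subsets n)) _) ⟩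
  length (filter (size≟ k) (map (outside ∷_) (subsets n)) ++ filter (size≟ k) (map (inside ∷_) (subsets n)))
    ≡⟨ length-++ (filter (size≟ k) (map (outside ∷_) (subsets n))) ⟩
  length (filter (size≟ k) (map (outside ∷_) (subsets n))) ℕ.+ length (filter (size≟ k) (map (inside ∷_) (subsets n)))
    ≡⟨ cong₂ ℕ._+_ (trans (length-filter-map (size≟ k) (outside ∷_) (subsets n)) (length-subsets-of-size n k))
                   (trans (length-filter-map (size≟ k) (inside ∷_) (subsets n)) (with-inside k)) ⟩
  n choose k ℕ.+ pred-choose k
    ≡⟨ pascal k ⟩
  suc n choose k ∎
  where
  open ≡-Reasoning
  size≟ : ∀ {m} k (D : Subset m) → Dec (∣ D ∣ ≡ k)
  size≟ k D = ∣ D ∣ ℕ.≟ k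

  -- Not `n choose (k ∸ 1)`, which would be 1 instead of 0 at `k = 0`.
  pred-choose : ℕ → ℕ
  pred-choose zero    = 0
  pred-choose (suc k) = n choose k

  with-inside : ∀ k → length (filter (λ (D : Subset n) → suc ∣ D ∣ ℕ.≟ k) (subsets n)) ≡ pred-choose k
  with-inside zero = cong length (none (subsets n))
    where
    none : ∀ Ds → filter (λ (D : Subset n) → suc ∣ D ∣ ℕ.≟ 0) Ds ≡ []
    none []       = refl
    none (D ∷ Ds) = none Ds
  with-inside (suc k) = trans
    (cong length (filter-≐ (λ D → suc ∣ D ∣ ℕ.≟ suc k) (size≟ k) (ℕ.suc-injective , cong suc) (subsets n)))
    (length-subsets-of-size n k)

  pascal : ∀ k → n choose k ℕ.+ pred-choose k ≡ suc n choose k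
  pascal zero    = refl
  pascal (suc k) = trans (ℕ.+-comm (n choose suc k) (n choose k)) (nCk+nC[k+1]≡[n+1]C[k+1] n k)

unique-∈-length : ∀ {xs} {D : Subset n} → Unique xs → All (_∈ D) xs → length xs ≤ ∣ D ∣
unique-∈-length []          []           = z≤n
unique-∈-length {D = D} (x∉ ∷ u) (x∈D ∷ xs∈D) =
  ℕ.≤-<-trans (unique-∈-length u (All.zipWith (λ (y∈D , x≢y) → x∈p∧x≢y⇒x∈p-y y∈D (x≢y ∘ sym)) (xs∈D , x∉)))
              (x∈p⇒∣p-x∣<∣p∣ x∈D)

∣D∣+unique-∉-length : ∀ {xs} {D : Subset n} → Unique xs → All (_∉ D) xs → ∣ D ∣ ℕ.+ length xs ≤ n
∣D∣+unique-∉-length {n} {xs} {D} u xs∉D = begin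
  ∣ D ∣ ℕ.+ length xs    ≤⟨ ℕ.+-monoʳ-≤ ∣ D ∣ (unique-∈-length u (All.map x∉p⇒x∈∁p xs∉D)) ⟩
  ∣ D ∣ ℕ.+ ∣ ∁ D ∣      ≡⟨ cong (∣ D ∣ ℕ.+_) (∣∁p∣≡n∸∣p∣ D) ⟩
  ∣ D ∣ ℕ.+ (n ∸ ∣ D ∣)  ≡⟨ ℕ.m+[n∸m]≡n (∣p∣≤n D) ⟩
  n                      ∎
  where open ℕ.≤-Reasoning

-- Isomorphism invariance of the counts

relabel : Permutation m n → Subset m → Subset n
relabel π D = Vec.tabulate (λ v → Vec.lookup D (π ⟨$⟩ˡ v))

∈-relabel : ∀ (π : Permutation m n) {D u} → u ∈ D → π ⟨$⟩ʳ u ∈ relabel π D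
∈-relabel π {D} {u} u∈D = Vec.lookup⇒[]= _ _ (trans (Vec.lookup∘tabulate _ (π ⟨$⟩ʳ u))
  (trans (cong (Vec.lookup D) (inverseˡ π)) (Vec.[]=⇒lookup u∈D)))

relabel-injective : ∀ (π : Permutation m n) {D E} → relabel π D ≡ relabel π E → D ≡ E
relabel-injective π {D} {E} eq = begin
  D                             ≡⟨ Vec.tabulate∘lookup D ⟨
  Vec.tabulate (Vec.lookup D)   ≡⟨ Vec.tabulate-cong lookup≗ ⟩
  Vec.tabulate (Vec.lookup E)   ≡⟨ Vec.tabulate∘lookup E ⟩
  E                             ∎
  where
  open ≡-Reasoning
  lookup≗ : ∀ u → Vec.lookup D u ≡ Vec.lookup E u
  lookup≗ u = begin
    Vec.lookup D u                              ≡⟨ cong (Vec.lookup D) (inverseˡ π) ⟨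
    Vec.lookup D (π ⟨$⟩ˡ (π ⟨$⟩ʳ u))            ≡⟨ Vec.lookup∘tabulate _ (π ⟨$⟩ʳ u) ⟨
    Vec.lookup (relabel π D) (π ⟨$⟩ʳ u)         ≡⟨ cong (λ F → Vec.lookup F (π ⟨$⟩ʳ u)) eq ⟩
    Vec.lookup (relabel π E) (π ⟨$⟩ʳ u)         ≡⟨ Vec.lookup∘tabulate _ (π ⟨$⟩ʳ u) ⟩
    Vec.lookup E (π ⟨$⟩ˡ (π ⟨$⟩ʳ u))            ≡⟨ cong (Vec.lookup E) (inverseˡ π) ⟩
    Vec.lookup E u                              ∎

indicator : Side → ℕ
indicator inside  = 1
indicator outside = 0

∣D∣≡sum : ∀ (D : Subset n) → ∣ D ∣ ≡ sum (indicator ∘ Vec.lookup D)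
∣D∣≡sum []            = refl
∣D∣≡sum (inside  ∷ D) = cong suc (∣D∣≡sum D)
∣D∣≡sum (outside ∷ D) = ∣D∣≡sum D

-- Written as a sum of indicators, cardinality inherits the invariance of sums under permutations.
∣relabel∣ : ∀ (π : Permutation m n) D → ∣ relabel π D ∣ ≡ ∣ D ∣
∣relabel∣ {n = n} π D = begin
  ∣ relabel π D ∣                                         ≡⟨ ∣D∣≡sum (relabel π D) ⟩
  sum (indicator ∘ Vec.lookup (relabel π D))         ≡⟨ sum-cong-≗ {n} (λ v → cong indicator (Vec.lookup∘tabulate (λ v → Vec.lookup D (π ⟨$⟩ˡ v)) v)) ⟩
  sum (λ v → indicator (Vec.lookup D (π ⟨$⟩ˡ v)))    ≡⟨ sum-permute (indicator ∘ Vec.lookup D) (flip π) ⟨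
  sum (indicator ∘ Vec.lookup D)                     ≡⟨ ∣D∣≡sum D ⟨
  ∣ D ∣                                                   ∎
  where open ≡-Reasoning

≅-sym : ∀ {G : SimpleGraph m} {H : SimpleGraph n} → G ≅ H → H ≅ G
≅-sym {G = G} {H} (π , adj) = flip π , λ u v → record
  { to        = λ uv → Equivalence.from (adj _ _) (adj-subst (sym (inverseʳ π)) (sym (inverseʳ π)) uv)
  ; from      = λ uv → adj-subst (inverseʳ π) (inverseʳ π) (Equivalence.to (adj _ _) uv)
  ; to-cong   = λ { refl → refl }
  ; from-cong = λ { refl → refl }
  }
  where
  adj-subst : ∀ {u u′ v v′} → u ≡ u′ → v ≡ v′ → Adj H u v → Adj H u′ v′
  adj-subst refl refl uv = uv

-- Relabelling along the isomorphism injects the total dominating sets of `G` into those of `H`. The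
-- inverse isomorphism later supplies the other inequality.
dₜ-≤ : ∀ {G : SimpleGraph m} {H : SimpleGraph n} → G ≅ H → ∀ i → dₜ G i ≤ dₜ H i
dₜ-≤ {G = G} {H} (π , adj) i = length-injection (λ D E → E ≡ relabel π D)
  (Unique.filter⁺ _ (subsets-unique _))
  (λ {D} D∈ →
    let _ , dominating , size = ∈-filter⁻ (λ D → totalDominating? G D ×-dec (∣ D ∣ ℕ.≟ i)) {xs = subsets _} D∈
    in relabel π D ,
       ∈-filter⁺ (λ D → totalDominating? H D ×-dec (∣ D ∣ ℕ.≟ i)) (∈-subsets _)
         (relabel-dominating dominating , trans (∣relabel∣ π D) size) ,
       refl)
  (λ _ _ eq eq′ → relabel-injective π (trans (sym eq) eq′))
  where
  relabel-dominating : ∀ {D} → TotalDominating G D → TotalDominating H (relabel π D)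
  relabel-dominating dominating v with u , u∈D , uv ← dominating (π ⟨$⟩ˡ v) =
    π ⟨$⟩ʳ u , ∈-relabel π u∈D ,
    subst (λ w → Adj H w (π ⟨$⟩ʳ u)) (inverseʳ π) (Equivalence.to (adj _ _) uv)

dₜ-invariant : ∀ {G : SimpleGraph m} {H : SimpleGraph n} → G ≅ H → ∀ i → dₜ G i ≡ dₜ H i
dₜ-invariant {G = G} {H} G≅H i =
  ℕ.≤-antisym (dₜ-≤ {G = G} {H} G≅H i) (dₜ-≤ {G = H} {G} (≅-sym {G = G} {H} G≅H) i)

-- Complements of pairs of vertices

adj⇒≢ : ∀ (G : SimpleGraph n) {u v} → Adj G u v → u ≢ v
adj⇒≢ G uv refl = irrefl G uv

module MinDegree₂ (G : SimpleGraph n) (2≤δ : 2 ≤ δ G) where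

  two-neighbours : ∀ v → ∃₂ λ a b → a ≢ b × Adj G v a × Adj G v b
  two-neighbours v = first-two (filter (adj? G v) (allFin n)) (Unique.filter⁺ (adj? G v) (Unique.allFin⁺ n))
    (proj₂ ∘ ∈-filter⁻ (adj? G v) {xs = allFin n})
    (ℕ.≤-trans 2≤δ (All.lookup (All.map⁻ (min≤xs n (map (deg G) (allFin n)))) (∈-allFin v)))
    where
    first-two : ∀ xs → Unique xs → (∀ {x} → x ∈ˡ xs → Adj G v x) → 2 ≤ length xs →
                ∃₂ λ a b → a ≢ b × Adj G v a × Adj G v b
    first-two (a ∷ b ∷ _) ((a≢b ∷ _) ∷ _) adj _ = a , b , a≢b , adj (here refl) , adj (there (here refl))
    first-two (_ ∷ []) _ _ (s≤s ())

  2≤n : 2 ≤ n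
  -- The minimum in `δ` is at most its default value, which is `n`.
  2≤n = ℕ.≤-trans 2≤δ (min≤⊤ n (map (deg G) (allFin n)))

  Undominated : Subset n → Fin n → Set
  Undominated D v = ∀ u → Adj G v u → u ∉ D

  undominated? : ∀ D v → Dec (Undominated D v)
  undominated? D v = Fin.all? λ u → adj? G v u →-dec ¬? (u ∈? D)

  undominated-vertex : ∀ {D} → ¬ TotalDominating G D → ∃[ v ] Undominated D v
  undominated-vertex {D} ¬dominating with Fin.any? (undominated? D)
  ... | yes v = v
  ... | no  ∄ = contradiction (λ v → decidable-stable (Fin.any? λ u → (u ∈? D) ×-dec adj? G v u)
                  λ ∄u → ∄ (v , λ u vu u∈D → ∄u (u , u∈D , vu))) ¬dominating

  ∣undominated∣ : ∀ {D v} → Undominated D v → ∣ D ∣ ℕ.+ 2 ≤ n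
  ∣undominated∣ {v = v} undom with a , b , a≢b , va , vb ← two-neighbours v =
    ∣D∣+unique-∉-length ((a≢b ∷ []) ∷ [] ∷ []) (undom a va ∷ undom b vb ∷ [])

  nonDominating? : ∀ j D → Dec (¬ TotalDominating G D × ∣ D ∣ ≡ j)
  nonDominating? j D = ¬? (totalDominating? G D) ×-dec (∣ D ∣ ℕ.≟ j)

  nonDominating : ℕ → List (Subset n)
  nonDominating j = filter (nonDominating? j) (subsets n)

  dₜ+nonDominating : ∀ j → dₜ G j ℕ.+ length (nonDominating j) ≡ n choose j
  dₜ+nonDominating j = trans (length-filter-split (totalDominating? G) (λ D → ∣ D ∣ ℕ.≟ j) (subsets n))
                             (length-subsets-of-size n j)

  -- A set that is not dominating misses two neighbours of some vertex, so all sets with at least n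
  -- - 1 elements dominate. This gives the top two coefficients.
  dₜ-top : ∀ {j} → n < j ℕ.+ 2 → dₜ G j ≡ n choose j
  dₜ-top {j} n<j+2 = begin
    dₜ G j                                  ≡⟨ ℕ.+-identityʳ _ ⟨
    dₜ G j ℕ.+ 0                            ≡⟨ cong (dₜ G j ℕ.+_) (cong length (none (subsets n))) ⟨
    dₜ G j ℕ.+ length (nonDominating j)     ≡⟨ dₜ+nonDominating j ⟩
    n choose j                              ∎
    where
    open ≡-Reasoning
    none : ∀ Ds → filter (nonDominating? j) Ds ≡ []
    none Ds = filter-none (nonDominating? j) {xs = Ds}
      (All.universal (λ { D (¬dominating , refl) →
        ℕ.<⇒≱ n<j+2 (∣undominated∣ (proj₂ (undominated-vertex ¬dominating))) }) Ds)

  dₜ-positive : ∀ {D} → TotalDominating G D → dₜ G ∣ D ∣ ≢ 0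
  dₜ-positive {D} dominating = ℕ.m<n⇒n≢0 (∈-length
    (∈-filter⁺ (λ E → totalDominating? G E ×-dec (∣ E ∣ ℕ.≟ ∣ D ∣)) (∈-subsets D) (dominating , refl)))

  -- Such a set can only be the complement of two neighbours of `v`: an element of one set missing
  -- from the other would be a third vertex outside the latter, besides the two neighbours.
  complement-determined : ∀ {D E v} → ∣ D ∣ ℕ.+ 2 ≡ n → ∣ E ∣ ℕ.+ 2 ≡ n →
    Undominated D v → Undominated E v → D ≡ E
  complement-determined {v = v} ∣D∣ ∣E∣ undomD undomE =
    ⊆-antisym (included ∣E∣ undomE undomD) (included ∣D∣ undomD undomE)
    where
    included : ∀ {D E x} → ∣ D ∣ ℕ.+ 2 ≡ n → Undominated D v → Undominated E v → x ∈ E → x ∈ D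
    included {D} {E} {x} ∣D∣ undomD undomE x∈E with a , b , a≢b , va , vb ← two-neighbours v =
      decidable-stable (x ∈? D) λ x∉D → ℕ.1+n≰n (begin
        suc n            ≡⟨ cong suc ∣D∣ ⟨
        suc (∣ D ∣ ℕ.+ 2) ≡⟨ ℕ.+-suc ∣ D ∣ 2 ⟨
        ∣ D ∣ ℕ.+ 3      ≤⟨ ∣D∣+unique-∉-length
                             (((λ { refl → undomE a va x∈E }) ∷ (λ { refl → undomE b vb x∈E }) ∷ [])
                               ∷ (a≢b ∷ []) ∷ [] ∷ [])
                             (x∉D ∷ undomD a va ∷ undomD b vb ∷ []) ⟩
        n                ∎)
      where open ℕ.≤-Reasoning

  -- The set is forced to be the complement of the neighbourhood of `u`, which then has exactly two
  -- elements; `unique` says that it contains no other vertex's neighbourhood.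
  record PrivateComplement (u : Fin n) : Set where
    field
      set         : Subset n
      size        : ∣ set ∣ ℕ.+ 2 ≡ n
      undominated : Undominated set u
      unique      : ∀ w → Undominated set w → w ≡ u

  -- Otherwise every non-dominating set of size n - 2 leaves some vertex other than u undominated, and such a vertex
  -- determines the set, so there are fewer than n of them.
  private-complement : ∀ {j} → j ℕ.+ 2 ≡ n → length (nonDominating j) ≡ n → ∀ u → PrivateComplement u
  private-complement {j} j+2≡n count u
    with Any.any? (λ D → undominated? D u ×-dec Fin.all? λ w → undominated? D w →-dec (w Fin.≟ u)) (nonDominating j)
  ... | yes some with D , D∈ , undom , unique ← find some
                 with _ , _ , refl ← ∈-filter⁻ (nonDominating? j) {xs = subsets n} D∈ =
    record { set = D ; size = j+2≡n ; undominated = undom ; unique = unique }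
  ... | no none = contradiction (begin-strict
    n                          ≡⟨ count ⟨
    length (nonDominating j)   ≤⟨ length-injection Undominated unique-sets image injective ⟩
    length others              <⟨ filter-notAll ≢u? (allFin n) (lose (∈-allFin u) λ u≢u → u≢u refl) ⟩
    length (allFin n)          ≡⟨ length-allFin n ⟩
    n                          ∎) (ℕ.<-irrefl refl)
    where
    open ℕ.≤-Reasoning
    ≢u? : ∀ w → Dec (w ≢ u)
    ≢u? w = ¬? (w Fin.≟ u)

    others : List (Fin n)
    others = filter ≢u? (allFin n)

    unique-sets : Unique (nonDominating j)
    unique-sets = Unique.filter⁺ (nonDominating? j) (subsets-unique n)

    image : ∀ {D} → D ∈ˡ nonDominating j → ∃[ w ] (w ∈ˡ others × Undominated D w)
    image {D} D∈ with Fin.any? (λ w → undominated? D w ×-dec ≢u? w)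
    ... | yes (w , undom , w≢u) = w , ∈-filter⁺ ≢u? (∈-allFin w) w≢u , undom
    ... | no  ∄
      with _ , ¬dominating , _ ← ∈-filter⁻ (nonDominating? j) {xs = subsets n} D∈
      with v , undom ← undominated-vertex ¬dominating
      = contradiction (lose D∈ (subst (Undominated D) (unique v undom) undom , unique)) none
      where
      unique : ∀ w → Undominated D w → w ≡ u
      unique w undom = decidable-stable (w Fin.≟ u) λ w≢u → ∄ (w , undom , w≢u)

    injective : ∀ {D E v} → D ∈ˡ nonDominating j → E ∈ˡ nonDominating j →
                Undominated D v → Undominated E v → D ≡ E
    injective D∈ E∈ with _ , _ , refl ← ∈-filter⁻ (nonDominating? j) {xs = subsets n} D∈
                       | _ , _ , ∣E∣≡j ← ∈-filter⁻ (nonDominating? j) {xs = subsets n} E∈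
      = complement-determined j+2≡n (trans (cong (ℕ._+ 2) ∣E∣≡j) j+2≡n)

-- 2-regular graphs with distinct neighbourhoods

record TwoRegularTwinFree (G : SimpleGraph n) : Set where
  field
    neighbours : ∀ v → ∃₂ λ a b → a ≢ b × Adj G v a × Adj G v b × (∀ {c} → Adj G v c → c ≡ a ⊎ c ≡ b)
    twin-free  : ∀ {u w} → (∀ {c} → Adj G w c → Adj G u c) → w ≡ u

  -- One step of a walk without turning back: having entered `v` from `a`, it must leave to `b`.
  other : ∀ {v a} → Adj G v a → ∃[ b ] (b ≢ a × Adj G v b × (∀ {c} → Adj G v c → c ≡ a ⊎ c ≡ b))
  other {v} va with neighbours v
  ... | x , y , x≢y , vx , vy , N with N va
  ...   | inj₁ refl = y , ≢-sym x≢y , vy , N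
  ...   | inj₂ refl = x , x≢y , vx , ⊎.swap ∘ N

  two-only : ∀ {v a b c} → a ≢ b → Adj G v a → Adj G v b → Adj G v c → c ≡ a ⊎ c ≡ b
  two-only a≢b va vb vc with x , _ , _ , N ← other va with N vb | N vc
  ... | inj₁ b≡a  | _         = contradiction (sym b≡a) a≢b
  ... | inj₂ refl | c≡a⊎c≡b   = c≡a⊎c≡b

-- A third neighbour of a vertex would be a third element outside its private set of size n - 2. If
-- all neighbours of `w` are neighbours of `u`, the private set of `u` leaves `w` undominated too.
twoRegularTwinFree : ∀ {G : SimpleGraph n} (2≤δ : 2 ≤ δ G) →
  (∀ u → MinDegree₂.PrivateComplement G 2≤δ u) → TwoRegularTwinFree G
twoRegularTwinFree {n} {G} 2≤δ complements = record
  { neighbours = λ v → let a , b , a≢b , va , vb = two-neighbours v in a , b , a≢b , va , vb , only a≢b va vb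
  ; twin-free  = λ {u} {w} sub → let open PrivateComplement (complements u) in
                   unique w λ x wx → undominated x (sub wx)
  }
  where
  open MinDegree₂ G 2≤δ
  only : ∀ {v a b c} → a ≢ b → Adj G v a → Adj G v b → Adj G v c → c ≡ a ⊎ c ≡ b
  only {v} {a} {b} {c} a≢b va vb vc with c Fin.≟ a | c Fin.≟ b
  ... | yes c≡a | _       = inj₁ c≡a
  ... | no _    | yes c≡b = inj₂ c≡b
  ... | no c≢a  | no c≢b  = contradiction (begin
    suc n              ≡⟨ cong suc size ⟨
    suc (∣ set ∣ ℕ.+ 2) ≡⟨ ℕ.+-suc ∣ set ∣ 2 ⟨
    ∣ set ∣ ℕ.+ 3      ≤⟨ ∣D∣+unique-∉-length ((c≢a ∷ c≢b ∷ []) ∷ (a≢b ∷ []) ∷ [] ∷ [])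
                           (undominated c vc ∷ undominated a va ∷ undominated b vb ∷ []) ⟩
    n                  ∎) ℕ.1+n≰n
    where
    open ℕ.≤-Reasoning
    open PrivateComplement (complements v)

-- Packing vertices without common neighbours

module Independent {G : SimpleGraph n} (regular : TwoRegularTwinFree G)
                   (2n≤3∣D∣ : ∀ {D} → TotalDominating G D → 2 ℕ.* n ≤ 3 ℕ.* ∣ D ∣) where
  open TwoRegularTwinFree regular

  -- The vertex `x` has two neighbours, `p` and `q`, whose further neighbours are `y` and `h`. Only
  -- `y` is prescribed by the caller, which allows two covers to be given a common element.
  second-neighbours : ∀ {x p y} → Adj G p x → Adj G p y → y ≢ x →
    ∃[ h ] ∀ {z w} → Adj G z x → Adj G z w → w ∈ˡ x ∷ y ∷ h ∷ []
  second-neighbours {x} {p} {y} px py y≢x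
    with q , q≢p , xq , N ← other (symm G px)
    with h , h≢x , qh , M ← other (symm G xq)
    = h , reach
    where
    reach : ∀ {z w} → Adj G z x → Adj G z w → w ∈ˡ x ∷ y ∷ h ∷ []
    reach zx zw with N (symm G zx)
    ... | inj₁ refl with two-only (≢-sym y≢x) px py zw
    ...   | inj₁ refl = here refl
    ...   | inj₂ refl = there (here refl)
    reach zx zw | inj₂ refl with M zw
    ...   | inj₁ refl = here refl
    ...   | inj₂ refl = there (there (here refl))

  -- Independence in the graph of common neighbours, not in `G` itself. In the same sense, `Covers`
  -- asks for the closed neighbourhoods of the members.
  Independent : List (Fin n) → Set
  Independent I = ∀ {x y z} → x ∈ˡ I → y ∈ˡ I → Adj G z x → Adj G z y → x ≡ y

  Covers : List (Fin n) → List (Fin n) → Set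
  Covers L I = ∀ {x z w} → x ∈ˡ I → Adj G z x → Adj G z w → w ∈ˡ L

  covers-∈ : ∀ {I L x} → Covers L I → x ∈ˡ I → x ∈ˡ L
  covers-∈ {x = x} cov x∈I with p , _ , _ , xp , _ ← neighbours x = cov x∈I (symm G xp) (symm G xp)

  complement : List (Fin n) → Subset n
  complement []      = ⊤
  complement (v ∷ I) = complement I - v

  ∉⇒∈complement : ∀ {x} I → x ∉ˡ I → x ∈ complement I
  ∉⇒∈complement []      _   = ∈⊤
  ∉⇒∈complement (v ∷ I) x∉ = x∈p∧x≢y⇒x∈p-y (∉⇒∈complement I (x∉ ∘ there)) (x∉ ∘ here)

  ∣complement∣ : ∀ {I} → Unique I → ∣ complement I ∣ ℕ.+ length I ≤ n
  ∣complement∣ []       = ℕ.≤-reflexive (trans (ℕ.+-identityʳ _) (∣⊤∣≡n n))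
  ∣complement∣ {v ∷ I} (v∉ ∷ u) = begin
    ∣ complement I - v ∣ ℕ.+ suc (length I)    ≡⟨ ℕ.+-suc _ (length I) ⟩
    suc ∣ complement I - v ∣ ℕ.+ length I      ≤⟨ ℕ.+-monoˡ-≤ (length I) (x∈p⇒∣p-x∣<∣p∣ (∉⇒∈complement I (All.All¬⇒¬Any v∉))) ⟩
    ∣ complement I ∣ ℕ.+ length I              ≤⟨ ∣complement∣ u ⟩
    n                                          ∎
    where open ℕ.≤-Reasoning

  -- Of the two neighbours of a vertex at most one lies in `I`.
  complement-dominating : ∀ {I} → Independent I → TotalDominating G (complement I)
  complement-dominating {I} ind z with neighbours z
  ... | a , b , a≢b , za , zb , _ with Any.any? (a Fin.≟_) I | Any.any? (b Fin.≟_) I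
  ...   | no a∉   | _       = a , ∉⇒∈complement I a∉ , za
  ...   | yes _   | no b∉   = b , ∉⇒∈complement I b∉ , zb
  ...   | yes a∈I | yes b∈I = contradiction (ind a∈I b∈I za zb) a≢b

  independent-small : ∀ {I} → Unique I → Independent I → 3 ℕ.* length I ≤ n
  independent-small {I} u ind = ℕ.+-cancelˡ-≤ (2 ℕ.* n) _ _ (begin
    2 ℕ.* n ℕ.+ 3 ℕ.* length I                ≤⟨ ℕ.+-monoˡ-≤ _ (2n≤3∣D∣ (complement-dominating ind)) ⟩
    3 ℕ.* ∣ complement I ∣ ℕ.+ 3 ℕ.* length I ≡⟨ ℕ.*-distribˡ-+ 3 ∣ complement I ∣ (length I) ⟨
    3 ℕ.* (∣ complement I ∣ ℕ.+ length I)     ≤⟨ ℕ.*-monoʳ-≤ 3 (∣complement∣ u) ⟩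
    3 ℕ.* n                                   ≡⟨ lemma n ⟩
    2 ℕ.* n ℕ.+ n                             ∎)
    where
    open ℕ.≤-Reasoning
    lemma : ∀ n → 3 ℕ.* n ≡ 2 ℕ.* n ℕ.+ n
    lemma = solve-∀

  -- By `second-neighbours` three entries per member always suffice for a cover; `efficient` records
  -- that at least one entry has been saved.
  record Packing : Set where
    field
      members     : List (Fin n)
      cover       : List (Fin n)
      unique      : Unique members
      independent : Independent members
      covers      : Covers cover members
      efficient   : length cover < 3 ℕ.* length members

  -- A vertex outside the cover shares no neighbour with a member. It adds three entries to the
  -- cover and three to the bound, so the saving persists.
  add : (P : Packing) → ∀ {v} → v ∉ˡ Packing.cover P →
    ∃[ P′ ] (v ∈ˡ Packing.cover P′ × (∀ {x} → x ∈ˡ Packing.cover P → x ∈ˡ Packing.cover P′))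
  add P {v} v∉
    with p , _ , _ , vp , _ ← neighbours v
    with y , y≢v , py , _ ← other (symm G vp)
    with h , reach ← second-neighbours (symm G vp) py y≢v
    = record
      { members     = v ∷ members
      ; cover       = v ∷ y ∷ h ∷ cover
      ; unique      = All.¬Any⇒All¬ members (v∉ ∘ covers-∈ covers) ∷ unique
      ; independent = λ { (here refl) (here refl) _ _ → refl
                        ; (here refl) (there y∈) zx zy → contradiction (covers y∈ zy zx) v∉
                        ; (there x∈) (here refl) zx zy → contradiction (covers x∈ zx zy) v∉
                        ; (there x∈) (there y∈) → independent x∈ y∈ }
      ; covers      = λ { (here refl) zx zw → ∈-++⁺ˡ (reach zx zw)
                        ; (there x∈) zx zw → there (there (there (covers x∈ zx zw))) }
      ; efficient   = subst (4 ℕ.+ length cover ≤_) (sym (ℕ.*-suc 3 (length members))) (ℕ.+-monoʳ-≤ 3 efficient)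
      } , here refl , there ∘ there ∘ there
    where open Packing P

  saturate : Packing → ∀ vs → ∃[ P ] (∀ {v} → v ∈ˡ vs → v ∈ˡ Packing.cover P)
  saturate P []       = P , λ ()
  saturate P (v ∷ vs) with saturate P vs
  ... | Q , vs⊆ with Any.any? (v Fin.≟_) (Packing.cover Q)
  ...   | yes v∈ = Q , λ { (here refl) → v∈ ; (there w∈) → vs⊆ w∈ }
  ...   | no  v∉ with R , v∈ , sub ← add Q v∉ = R , λ { (here refl) → v∈ ; (there w∈) → sub (vs⊆ w∈) }

  -- Greedy extension makes the cover contain all vertices, and then n ≤ |cover| < 3 |members| ≤ n.
  no-packing : ¬ Packing
  no-packing P₀ with P , all ← saturate P₀ (allFin n) = ℕ.<-irrefl refl (begin-strict
    n                          ≡⟨ length-allFin n ⟨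
    length (allFin n)          ≤⟨ unique-⊆-length (Unique.allFin⁺ n) all ⟩
    length cover               <⟨ efficient ⟩
    3 ℕ.* length members       ≤⟨ independent-small unique independent ⟩
    n                          ∎)
    where
    open ℕ.≤-Reasoning
    open Packing P

  -- Two vertices s, t at distance 2 from x share the second neighbour x, so that without a common neighbour they
  -- would start a packing whose cover has only five elements.
  common-neighbour : ∀ {x p q s t} → Adj G p x → Adj G p s → s ≢ x → Adj G q x → Adj G q t → t ≢ x → s ≢ t →
    ∃[ z ] (Adj G z s × Adj G z t)
  common-neighbour {x} {p} {q} {s} {t} px ps s≢x qx qt t≢x s≢t
    with Fin.any? (λ z → adj? G z s ×-dec adj? G z t)
  ... | yes z = z
  ... | no ∄
    with h , reach-s ← second-neighbours ps px (≢-sym s≢x)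
    with k , reach-t ← second-neighbours qt qx (≢-sym t≢x)
    = contradiction (record
      { members     = s ∷ t ∷ []
      ; cover       = s ∷ x ∷ h ∷ t ∷ k ∷ []
      ; unique      = (s≢t ∷ []) ∷ [] ∷ []
      ; independent = λ { (here refl) (here refl) _ _ → refl
                        ; (here refl) (there (here refl)) zs zt → contradiction (_ , zs , zt) ∄
                        ; (there (here refl)) (here refl) zt zs → contradiction (_ , zs , zt) ∄
                        ; (there (here refl)) (there (here refl)) _ _ → refl }
      ; covers      = λ { (here refl) zx zw → ∈-++⁺ˡ (reach-s zx zw)
                        ; (there (here refl)) zx zw → rearrange (reach-t zx zw) }
      ; efficient   = ℕ.≤-refl
      }) no-packing
    where
    rearrange : ∀ {h k w} → w ∈ˡ t ∷ x ∷ k ∷ [] → w ∈ˡ s ∷ x ∷ h ∷ t ∷ k ∷ []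
    rearrange (here eq)                 = there (there (there (here eq)))
    rearrange (there (here eq))         = there (here eq)
    rearrange (there (there (here eq))) = there (there (there (there (here eq))))

-- Recognising the cycles

-- In a 2-regular graph an injective homomorphism from a graph of minimum degree 2 already exhausts the neighbours of
-- every vertex in its image, so the image is a union of components.
module _ {G : SimpleGraph n} {H : SimpleGraph m} (regular : TwoRegularTwinFree G) (connected : Connected G)
         (2≤δ : 2 ≤ δ H) (f : Fin m → Fin n) (f-injective : ∀ {i j} → f i ≡ f j → i ≡ j)
         (f-adj : ∀ {i j} → Adj H i j → Adj G (f i) (f j)) (i₀ : Fin m) where
  open TwoRegularTwinFree regular

  neighbour-lift : ∀ {i v} → Adj G (f i) v → ∃[ j ] (Adj H i j × f j ≡ v)
  neighbour-lift {i} iv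
    with a , b , a≢b , ia , ib ← MinDegree₂.two-neighbours H 2≤δ i
    with two-only (a≢b ∘ f-injective) (f-adj ia) (f-adj ib) iv
  ... | inj₁ v≡fa = a , ia , sym v≡fa
  ... | inj₂ v≡fb = b , ib , sym v≡fb

  onto : ∀ v → ∃[ i ] f i ≡ v
  onto v = walk i₀ (connected (f i₀) v)
    where
    walk : ∀ i {v} → Star (Adj G) (f i) v → ∃[ j ] f j ≡ v
    walk i ε = i , refl
    walk i (uv ◅ path) with j , _ , refl ← neighbour-lift uv = walk j path

  injective-hom⇒≅ : G ≅ H
  injective-hom⇒≅ = permutation f⁻¹ f (λ i → f-injective (proj₂ (onto (f i)))) (λ v → proj₂ (onto v)) ,
    λ u v → mk⇔ (reflect ∘ subst₂-adj (sym (proj₂ (onto u))) (sym (proj₂ (onto v))))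
                (subst₂-adj (proj₂ (onto u)) (proj₂ (onto v)) ∘ f-adj)
    where
    f⁻¹ : Fin n → Fin m
    f⁻¹ v = proj₁ (onto v)

    subst₂-adj : ∀ {u u′ v v′} → u ≡ u′ → v ≡ v′ → Adj G u v → Adj G u′ v′
    subst₂-adj refl refl uv = uv

    reflect : ∀ {i j} → Adj G (f i) (f j) → Adj H i j
    reflect ij with k , ik , fk≡fj ← neighbour-lift ij with refl ← f-injective fk≡fj = ik

module _ {G : SimpleGraph n} (regular : TwoRegularTwinFree G) (connected : Connected G) where

  triangle⇒≅C₃ : ∀ {u v w} → Adj G u v → Adj G v w → Adj G w u → G ≅ C 3
  triangle⇒≅C₃ {u} {v} {w} uv vw wu =
    -- The bound on `δ (C 3)` is a literal because the minimum degree evaluates to 2.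
    injective-hom⇒≅ {H = C 3} regular connected (s≤s (s≤s z≤n)) (lookup vs) (lookup-injective distinct)
      (λ {i} {j} → [ edge i j , symm G ∘ edge j i ]′) 0F
    where
    vs = u ∷ v ∷ w ∷ []

    distinct : Unique vs
    distinct = (adj⇒≢ G uv ∷ ≢-sym (adj⇒≢ G wu) ∷ []) ∷ (adj⇒≢ G vw ∷ []) ∷ [] ∷ []

    edge : ∀ (i j : Fin 3) → toℕ j ≡ suc (toℕ i) % 3 → Adj G (lookup vs i) (lookup vs j)
    edge 0F j eq with refl ← Fin.toℕ-injective {j = 1F} eq = uv
    edge 1F j eq with refl ← Fin.toℕ-injective {j = 2F} eq = vw
    edge 2F j eq with refl ← Fin.toℕ-injective {j = 0F} eq = wu

  hexagon⇒≅C₆ : ∀ {v₀ v₁ v₂ v₃ v₄ v₅} → Unique (v₀ ∷ v₁ ∷ v₂ ∷ v₃ ∷ v₄ ∷ v₅ ∷ []) →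
    Adj G v₀ v₁ → Adj G v₁ v₂ → Adj G v₂ v₃ → Adj G v₃ v₄ → Adj G v₄ v₅ → Adj G v₅ v₀ → G ≅ C 6
  hexagon⇒≅C₆ {v₀} {v₁} {v₂} {v₃} {v₄} {v₅} distinct e₀ e₁ e₂ e₃ e₄ e₅ =
    injective-hom⇒≅ {H = C 6} regular connected (s≤s (s≤s z≤n)) (lookup vs) (lookup-injective distinct)
      (λ {i} {j} → [ edge i j , symm G ∘ edge j i ]′) 0F
    where
    vs = v₀ ∷ v₁ ∷ v₂ ∷ v₃ ∷ v₄ ∷ v₅ ∷ []

    edge : ∀ (i j : Fin 6) → toℕ j ≡ suc (toℕ i) % 6 → Adj G (lookup vs i) (lookup vs j)
    edge 0F j eq with refl ← Fin.toℕ-injective {j = 1F} eq = e₀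
    edge 1F j eq with refl ← Fin.toℕ-injective {j = 2F} eq = e₁
    edge 2F j eq with refl ← Fin.toℕ-injective {j = 3F} eq = e₂
    edge 3F j eq with refl ← Fin.toℕ-injective {j = 4F} eq = e₃
    edge 4F j eq with refl ← Fin.toℕ-injective {j = 5F} eq = e₄
    edge 5F j eq with refl ← Fin.toℕ-injective {j = 0F} eq = e₅

  -- The walk v₅ v₀ v₁ v₂ v₃ is centred at an arbitrary vertex v₁. Either v₅ = v₂ and it closes up
  -- as a triangle, or v₃ and v₅, which both share a neighbour with v₁, share a neighbour v₄ that
  -- completes a hexagon.
  ≅C₃⊎≅C₆ : Fin n → (∀ {D} → TotalDominating G D → 2 ℕ.* n ≤ 3 ℕ.* ∣ D ∣) → G ≅ C 3 ⊎ G ≅ C 6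
  ≅C₃⊎≅C₆ v₁ 2n≤3∣D∣
    with v₀ , v₂ , v₀≢v₂ , v₁v₀ , v₁v₂ , N₁ ← TwoRegularTwinFree.neighbours regular v₁
    with v₅ , v₅≢v₁ , v₀v₅ , N₀ ← TwoRegularTwinFree.other regular (symm G v₁v₀)
    with v₃ , v₃≢v₁ , v₂v₃ , N₂ ← TwoRegularTwinFree.other regular (symm G v₁v₂)
    with v₅ Fin.≟ v₂
  ... | yes refl = inj₁ (triangle⇒≅C₃ v₁v₂ (symm G v₀v₅) (symm G v₁v₀))
  ... | no v₅≢v₂ = inj₂ (hexagon⇒≅C₆
    ( (≢-sym (adj⇒≢ G v₁v₀) ∷ v₀≢v₂ ∷ ≢-sym v₃≢v₀ ∷ ≢-sym v₄≢v₀ ∷ adj⇒≢ G v₀v₅ ∷ [])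
    ∷ (adj⇒≢ G v₁v₂ ∷ ≢-sym v₃≢v₁ ∷ ≢-sym v₄≢v₁ ∷ ≢-sym v₅≢v₁ ∷ [])
    ∷ (adj⇒≢ G v₂v₃ ∷ ≢-sym v₄≢v₂ ∷ ≢-sym v₅≢v₂ ∷ [])
    ∷ (≢-sym (adj⇒≢ G v₄v₃) ∷ v₃≢v₅ ∷ [])
    ∷ (adj⇒≢ G v₄v₅ ∷ [])
    ∷ [] ∷ [])
    (symm G v₁v₀) v₁v₂ v₂v₃ (symm G v₄v₃) v₄v₅ (symm G v₀v₅))
    where
    v₃≢v₀ : v₃ ≢ v₀
    v₃≢v₀ refl with N₀ (symm G v₂v₃)
    ... | inj₁ refl = irrefl G v₁v₂
    ... | inj₂ refl = v₅≢v₂ refl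

    -- If they coincided, both neighbours of v₁ would be neighbours of v₃, and v₁ and v₃ would be
    -- twins.
    v₃≢v₅ : v₃ ≢ v₅
    v₃≢v₅ refl = v₃≢v₁ (sym (TwoRegularTwinFree.twin-free regular
      λ v₁c → [ (λ { refl → symm G v₀v₅ }) , (λ { refl → symm G v₂v₃ }) ]′ (N₁ v₁c)))

    apex : ∃[ v₄ ] (Adj G v₄ v₃ × Adj G v₄ v₅)
    apex = Independent.common-neighbour regular 2n≤3∣D∣
      (symm G v₁v₂) v₂v₃ v₃≢v₁ (symm G v₁v₀) v₀v₅ v₅≢v₁ v₃≢v₅
    v₄ = proj₁ apex
    v₄v₃ = proj₁ (proj₂ apex)
    v₄v₅ = proj₂ (proj₂ apex)

    -- Each of v₀, v₁, v₂ has both its neighbours known, and v₃ or v₅ is not among them, whereas v₄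
    -- is adjacent to both.
    v₄≢v₀ : v₄ ≢ v₀
    v₄≢v₀ v₄≡v₀ = [ v₃≢v₁ , v₃≢v₅ ]′ (N₀ (subst (λ v → Adj G v v₃) v₄≡v₀ v₄v₃))

    v₄≢v₁ : v₄ ≢ v₁
    v₄≢v₁ v₄≡v₁ = [ v₃≢v₀ , ≢-sym (adj⇒≢ G v₂v₃) ]′ (N₁ (subst (λ v → Adj G v v₃) v₄≡v₁ v₄v₃))

    v₄≢v₂ : v₄ ≢ v₂
    v₄≢v₂ v₄≡v₂ = [ v₅≢v₁ , ≢-sym v₃≢v₅ ]′ (N₂ (subst (λ v → Adj G v v₅) v₄≡v₂ v₄v₅))

-- Reading off the coefficients

choose-complement : ∀ {n} i j → i ℕ.+ j ≡ n → n choose j ≡ n choose i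
choose-complement i j refl = trans (nCk≡nC[n∸k] (ℕ.m≤n+m j i)) (cong ((i ℕ.+ j) choose_) (ℕ.m+n∸n≡m i j))

[1+n]choose2 : ∀ n → suc n choose 2 ≡ n ℕ.+ n choose 2
[1+n]choose2 n = trans (sym (nCk+nC[k+1]≡[n+1]C[k+1] n 1)) (cong (ℕ._+ n choose 2) (nC1≡n n))

-- Pairs from `b` triples: 9 for every two triples and 3 inside each triple. In this form the first
-- summand is the coefficient of xⁿ⁻², and the second is n.
[b*3]choose2 : ∀ b → (b ℕ.* 3) choose 2 ≡ (b choose 2) ℕ.* 9 ℕ.+ b ℕ.* 3
[b*3]choose2 zero    = refl
[b*3]choose2 (suc b) = begin
  suc (suc (suc (b ℕ.* 3))) choose 2
    ≡⟨ [1+n]choose2 (suc (suc (b ℕ.* 3))) ⟩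
  suc (suc (b ℕ.* 3)) ℕ.+ suc (suc (b ℕ.* 3)) choose 2
    ≡⟨ cong (suc (suc (b ℕ.* 3)) ℕ.+_) ([1+n]choose2 (suc (b ℕ.* 3))) ⟩
  suc (suc (b ℕ.* 3)) ℕ.+ (suc (b ℕ.* 3) ℕ.+ suc (b ℕ.* 3) choose 2)
    ≡⟨ cong (λ k → suc (suc (b ℕ.* 3)) ℕ.+ (suc (b ℕ.* 3) ℕ.+ k)) 
            (trans ([1+n]choose2 (b ℕ.* 3)) (cong (b ℕ.* 3 ℕ.+_) ([b*3]choose2 b))) ⟩
  suc (suc (b ℕ.* 3)) ℕ.+ (suc (b ℕ.* 3) ℕ.+ (b ℕ.* 3 ℕ.+ ((b choose 2) ℕ.* 9 ℕ.+ b ℕ.* 3)))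
    ≡⟨ lemma b (b choose 2) ⟩
  (b ℕ.+ b choose 2) ℕ.* 9 ℕ.+ suc b ℕ.* 3
    ≡⟨ cong (λ k → k ℕ.* 9 ℕ.+ suc b ℕ.* 3) ([1+n]choose2 b) ⟨
  (suc b choose 2) ℕ.* 9 ℕ.+ suc b ℕ.* 3 ∎
  where
  open ≡-Reasoning
  lemma : ∀ b c → suc (suc (b ℕ.* 3)) ℕ.+ (suc (b ℕ.* 3) ℕ.+ (b ℕ.* 3 ℕ.+ (c ℕ.* 9 ℕ.+ b ℕ.* 3)))
                ≡ (b ℕ.+ c) ℕ.* 9 ℕ.+ suc b ℕ.* 3
  lemma = solve-∀

module _ (G : SimpleGraph n) (connected : Connected G) (2≤δ : 2 ≤ δ G)
         {b : ℕ} (coefficients : ∀ i j → i ℕ.+ j ≡ n → dₜ G j ≡ (b choose i) ℕ.* 3 ℕ.^ i) where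
  open MinDegree₂ G 2≤δ

  n≡b*3 : n ≡ b ℕ.* 3
  n≡b*3 = begin
    n                      ≡⟨ nC1≡n n ⟨
    n choose 1             ≡⟨ choose-complement 1 (n ∸ 1) 1+j≡n ⟨
    n choose (n ∸ 1)       ≡⟨ dₜ-top (ℕ.≤-reflexive (trans (cong suc (sym 1+j≡n)) (ℕ.+-comm 2 (n ∸ 1)))) ⟨
    dₜ G (n ∸ 1)           ≡⟨ coefficients 1 (n ∸ 1) 1+j≡n ⟩
    (b choose 1) ℕ.* 3     ≡⟨ cong (ℕ._* 3) (nC1≡n b) ⟩
    b ℕ.* 3                ∎
    where
    open ≡-Reasoning
    1+j≡n : 1 ℕ.+ (n ∸ 1) ≡ n
    1+j≡n = ℕ.m+[n∸m]≡n (ℕ.≤-trans (s≤s z≤n) 2≤n)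

  length-nonDominating : length (nonDominating (n ∸ 2)) ≡ n
  length-nonDominating = ℕ.+-cancelˡ-≡ ((b choose 2) ℕ.* 9) _ _ (begin
    (b choose 2) ℕ.* 9 ℕ.+ length (nonDominating (n ∸ 2))
      ≡⟨ cong (ℕ._+ length (nonDominating (n ∸ 2))) (coefficients 2 (n ∸ 2) 2+j≡n) ⟨
    dₜ G (n ∸ 2) ℕ.+ length (nonDominating (n ∸ 2))  ≡⟨ dₜ+nonDominating (n ∸ 2) ⟩
    n choose (n ∸ 2)                                 ≡⟨ choose-complement 2 (n ∸ 2) 2+j≡n ⟩
    n choose 2                                       ≡⟨ cong (_choose 2) n≡b*3 ⟩
    (b ℕ.* 3) choose 2                               ≡⟨ [b*3]choose2 b ⟩
    (b choose 2) ℕ.* 9 ℕ.+ b ℕ.* 3                   ≡⟨ cong ((b choose 2) ℕ.* 9 ℕ.+_) n≡b*3 ⟨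
    (b choose 2) ℕ.* 9 ℕ.+ n                         ∎)
    where
    open ≡-Reasoning
    2+j≡n : 2 ℕ.+ (n ∸ 2) ≡ n
    2+j≡n = ℕ.m+[n∸m]≡n 2≤n

  -- A dominating `D` makes the coefficient at its size nonzero, so n - |D| is at most `b`, which is
  -- a third of n.
  2n≤3∣D∣ : ∀ {D} → TotalDominating G D → 2 ℕ.* n ≤ 3 ℕ.* ∣ D ∣
  2n≤3∣D∣ {D} dominating = ℕ.+-cancelˡ-≤ n _ _ (begin
    n ℕ.+ 2 ℕ.* n                         ≡⟨ cong (λ k → k ℕ.+ 2 ℕ.* k) n≡ ⟩
    i ℕ.+ ∣ D ∣ ℕ.+ 2 ℕ.* (i ℕ.+ ∣ D ∣)   ≡⟨ lemma i ∣ D ∣ ⟩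
    i ℕ.* 3 ℕ.+ 3 ℕ.* ∣ D ∣               ≤⟨ ℕ.+-monoˡ-≤ (3 ℕ.* ∣ D ∣) (ℕ.*-monoˡ-≤ 3 i≤b) ⟩
    b ℕ.* 3 ℕ.+ 3 ℕ.* ∣ D ∣               ≡⟨ cong (ℕ._+ 3 ℕ.* ∣ D ∣) n≡b*3 ⟨
    n ℕ.+ 3 ℕ.* ∣ D ∣                     ∎)
    where
    open ℕ.≤-Reasoning
    i = n ∸ ∣ D ∣

    n≡ : n ≡ i ℕ.+ ∣ D ∣
    n≡ = sym (ℕ.m∸n+n≡m (∣p∣≤n D))

    i≤b : i ≤ b
    i≤b = ℕ.≮⇒≥ λ b<i → dₜ-positive dominating
      (trans (coefficients i ∣ D ∣ (sym n≡)) (cong (ℕ._* 3 ℕ.^ i) (k>n⇒nCk≡0 b<i)))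

    lemma : ∀ i d → i ℕ.+ d ℕ.+ 2 ℕ.* (i ℕ.+ d) ≡ i ℕ.* 3 ℕ.+ 3 ℕ.* d
    lemma = solve-∀

  binomial⇒≅C₃⊎≅C₆ : G ≅ C 3 ⊎ G ≅ C 6
  binomial⇒≅C₃⊎≅C₆ = ≅C₃⊎≅C₆
    (twoRegularTwinFree 2≤δ (private-complement (ℕ.m∸n+n≡m 2≤n) length-nonDominating))
    connected (fromℕ< (ℕ.≤-trans (s≤s z≤n) 2≤n)) 2n≤3∣D∣

theorem4p7 : ∀ {c ℓ₁ ℓ₂} (K : AlgebraicallyClosedField₀ c ℓ₁ ℓ₂)
    {n : ℕ} (G : SimpleGraph n) → Connected G → 2 ≤ δ G →
    (Z K (Dₜ G) ≐ ｛-3,0｝ K) ⇔ (G ≅ C 3 ⊎ G ≅ C 6)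
theorem4p7 K {n} G connected 2≤δ = mk⇔ only-cycles [ triangle , hexagon ]′
  where
  open Roots K

  only-cycles : Z K (Dₜ G) ≐ ｛-3,0｝ K → G ≅ C 3 ⊎ G ≅ C 6
  only-cycles (roots , _)
    with b , coefficients ← binomial-coefficients n (dₜ G)
           -- The polynomial is monic: the whole vertex set dominates.
           (trans (MinDegree₂.dₜ-top G 2≤δ (ℕ.m<m+n n (s≤s z≤n))) (nCn≡1 n)) roots
    = binomial⇒≅C₃⊎≅C₆ G connected 2≤δ coefficients

  triangle : G ≅ C 3 → Z K (Dₜ G) ≐ ｛-3,0｝ K
  -- The permutation forces `n` to be 3, so that both coefficient vectors have the same length.
  triangle G≅C₃@(π , _) with refl ← ↔⇒≡ π = C₃-roots (dₜ G) (dₜ-invariant {G = G} {C 3} G≅C₃)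

  hexagon : G ≅ C 6 → Z K (Dₜ G) ≐ ｛-3,0｝ K
  hexagon G≅C₆@(π , _) with refl ← ↔⇒≡ π = C₆-roots (dₜ G) (dₜ-invariant {G = G} {C 6} G≅C₆)
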